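{- Every $\mathbf{A}\in\mathsf{BI}(d1,\mathrm{ca}_\to)$ satisfies $a\wedge\neg a=0$ for all $a\in A$.
   Context: A BALFI (Boolean algebra with LFI operators) is an algebra $\mathbf{B}=\langle B,\wedge,\vee,\to,\neg,\circ,0,1\rangle$, with unary operations $\neg,\circ$, such that $\langle B,\wedge,\vee,\to,0,1\rangle$ is a Boolean algebra and, for every $a\in B$, $a\vee\neg a=1$ and $a\wedge\neg a\wedge\circ a=0$ (in general $\neg$ is not the Boolean complement). $\mathsf{BI}(d1,\mathrm{ca}_\to)$ is the class of all BALFIs satisfying, for all elements $a,b$: - $(d1)$: $\circ a\vee a=1$; - $(\mathrm{ca}_\to)$: $(\circ a\wedge\circ b)\wedge\circ(a\to b)=\circ a\wedge\circ b$. -}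

module Defs where

open import Algebra.Core using (Op₁; Op₂)
open import Algebra.Definitions using (Congruent₁)
open import Algebra.Lattice.Structures using (IsBooleanAlgebra)
open import Level using (suc; _⊔_)
open import Relation.Binary.Core using (Rel)

-- Implication _⇒_ is primitive, as in the signature ⟨B,∧,∨,→,0,1⟩, so the
-- Boolean complement is the term x ⇒ 0#, and ⇒-def says that _⇒_ is the
-- Boolean (material) implication.  The paraconsistent negation ¬_ is a further
-- operation, unrelated to the complement except through the two BALFI axioms.
-- Since equality is a setoid equality, ¬_ and ∘_ must be assumed congruent;
-- congruence of _⇒_ follows from isBooleanAlgebra and ⇒-def.

record BALFI c ℓ : Set (suc (c ⊔ ℓ)) where
  infix  8 ¬_ ∘_
  infixr 7 _∧_
  infixr 6 _∨_
  infixr 5 _⇒_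
  infix  4 _≈_
  field
    Carrier : Set c
    _≈_     : Rel Carrier ℓ
    _∧_     : Op₂ Carrier
    _∨_     : Op₂ Carrier
    _⇒_     : Op₂ Carrier
    ¬_      : Op₁ Carrier
    ∘_      : Op₁ Carrier
    0#      : Carrier
    1#      : Carrier

    isBooleanAlgebra : IsBooleanAlgebra _≈_ _∨_ _∧_ (λ x → x ⇒ 0#) 1# 0#
    ⇒-def            : ∀ x y → (x ⇒ y) ≈ ((x ⇒ 0#) ∨ y)

    ¬-cong           : Congruent₁ _≈_ ¬_
    ∘-cong           : Congruent₁ _≈_ ∘_

    a∨¬a≈1           : ∀ a → (a ∨ ¬ a) ≈ 1#
    a∧¬a∧∘a≈0        : ∀ a → (a ∧ ¬ a ∧ ∘ a) ≈ 0#

  open IsBooleanAlgebra isBooleanAlgebra public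
    renaming (¬-cong to complement-cong)

record BI⟨d1,ca→⟩ c ℓ : Set (suc (c ⊔ ℓ)) where
  field
    balfi : BALFI c ℓ

  open BALFI balfi public

  field
    d1  : ∀ a → (∘ a ∨ a) ≈ 1#
    ca→ : ∀ a b → ((∘ a ∧ ∘ b) ∧ ∘ (a ⇒ b)) ≈ (∘ a ∧ ∘ b)

{-# OPTIONS --safe #-}
module Submission where

open import Defs
open import Algebra.Lattice.Bundles using (BooleanAlgebra)
import Algebra.Lattice.Properties.BooleanAlgebra as BooleanAlgebraProperties
import Relation.Binary.Reasoning.Setoid as SetoidReasoning

-- Write ~ a for the Boolean complement a ⇒ 0.  Axiom d1 gives ∘ 0 = 1 and
-- a ≤ ∘ (~ a), and ca→ applied to ~ a and 0 gives ∘ (~ a) ∧ ∘ 0 ≤ ∘ (~ ~ a) = ∘ a.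
-- Hence a ≤ ∘ a, so that a ∧ ¬ a = a ∧ ¬ a ∧ ∘ a = 0.

module _ {c ℓ} (B : BooleanAlgebra c ℓ) where
  open BooleanAlgebra B
  open BooleanAlgebraProperties B
  open SetoidReasoning setoid

  -- Here `¬` is the Boolean complement, so this turns an instance of `d1` at a complement into an
  -- inequality, with y ≤ x encoded as `y ∧ x ≈ y`.
  x∨¬y≈1⇒y∧x≈y : ∀ x y → (x ∨ ¬ y) ≈ ⊤ → (y ∧ x) ≈ y
  x∨¬y≈1⇒y∧x≈y x y x∨¬y≈1 = begin
    y ∧ x               ≈⟨ ∨-identityʳ (y ∧ x) ⟨
    (y ∧ x) ∨ ⊥         ≈⟨ ∨-congˡ (∧-complementʳ y) ⟨
    (y ∧ x) ∨ (y ∧ ¬ y) ≈⟨ ∧-distribˡ-∨ y x (¬ y) ⟨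
    y ∧ (x ∨ ¬ y)       ≈⟨ ∧-congˡ x∨¬y≈1 ⟩
    y ∧ ⊤               ≈⟨ ∧-identityʳ y ⟩
    y                   ∎

module _ {c ℓ} (A : BI⟨d1,ca→⟩ c ℓ) where
  open BI⟨d1,ca→⟩ A

  booleanAlgebra : BooleanAlgebra c ℓ
  booleanAlgebra = record { isBooleanAlgebra = isBooleanAlgebra }

  open BooleanAlgebraProperties booleanAlgebra
    using (∧-identityʳ; ∨-identityʳ; ¬-involutive)
  open SetoidReasoning (BooleanAlgebra.setoid booleanAlgebra)

  ∘0≈1 : ∘ 0# ≈ 1#
  ∘0≈1 = trans (sym (∨-identityʳ (∘ 0#))) (d1 0#)

  ∘~a∧∘a≈∘~a : ∀ a → (∘ (a ⇒ 0#) ∧ ∘ a) ≈ ∘ (a ⇒ 0#)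
  ∘~a∧∘a≈∘~a a = begin
    ∘ (a ⇒ 0#) ∧ ∘ a
      -- Rewritten backwards to expose the left side of `ca→`; `¬-involutive` concerns the
      -- complement `_ ⇒ 0#`, not the paraconsistent `¬`.
      ≈⟨ ∧-cong ∘~a∧∘0≈∘~a (∘-cong (¬-involutive a)) ⟨
    (∘ (a ⇒ 0#) ∧ ∘ 0#) ∧ ∘ ((a ⇒ 0#) ⇒ 0#)
      ≈⟨ ca→ (a ⇒ 0#) 0# ⟩
    ∘ (a ⇒ 0#) ∧ ∘ 0#
      ≈⟨ ∘~a∧∘0≈∘~a ⟩
    ∘ (a ⇒ 0#) ∎
    where
    ∘~a∧∘0≈∘~a : (∘ (a ⇒ 0#) ∧ ∘ 0#) ≈ ∘ (a ⇒ 0#)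
    ∘~a∧∘0≈∘~a = trans (∧-congˡ ∘0≈1) (∧-identityʳ (∘ (a ⇒ 0#)))

  -- Transitivity of the order along a ≤ ∘ (~ a) ≤ ∘ a, carried out with meets.
  a∧∘a≈a : ∀ a → (a ∧ ∘ a) ≈ a
  a∧∘a≈a a = begin
    a ∧ ∘ a                 ≈⟨ ∧-congʳ a∧∘~a≈a ⟨
    (a ∧ ∘ (a ⇒ 0#)) ∧ ∘ a  ≈⟨ ∧-assoc a (∘ (a ⇒ 0#)) (∘ a) ⟩
    a ∧ (∘ (a ⇒ 0#) ∧ ∘ a)  ≈⟨ ∧-congˡ (∘~a∧∘a≈∘~a a) ⟩
    a ∧ ∘ (a ⇒ 0#)          ≈⟨ a∧∘~a≈a ⟩
    a                       ∎
    where
    a∧∘~a≈a : (a ∧ ∘ (a ⇒ 0#)) ≈ a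
    -- The complement in `booleanAlgebra` is by definition `_ ⇒ 0#`, so `d1` at `a ⇒ 0#` is exactly
    -- the premise.
    a∧∘~a≈a = x∨¬y≈1⇒y∧x≈y booleanAlgebra (∘ (a ⇒ 0#)) a (d1 (a ⇒ 0#))

theorem3p13 : ∀ {c ℓ} (A : BI⟨d1,ca→⟩ c ℓ) → let open BI⟨d1,ca→⟩ A in
    ∀ (a : Carrier) → (a ∧ ¬ a) ≈ 0#
theorem3p13 A a = begin
  -- Inserting the factor `∘ a` brings in the BALFI axiom for the paraconsistent `¬`.
  a ∧ ¬ a          ≈⟨ ∧-congʳ (a∧∘a≈a A a) ⟨
  (a ∧ ∘ a) ∧ ¬ a  ≈⟨ ∧-assoc a (∘ a) (¬ a) ⟩
  a ∧ (∘ a ∧ ¬ a)  ≈⟨ ∧-congˡ (∧-comm (∘ a) (¬ a)) ⟩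
  a ∧ ¬ a ∧ ∘ a    ≈⟨ a∧¬a∧∘a≈0 a ⟩
  0#               ∎
  where
  open BI⟨d1,ca→⟩ A
  open SetoidReasoning (BooleanAlgebra.setoid (booleanAlgebra A))
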